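{- Let $y,z$ be nonzero complex numbers and let $u_n=u_n(y,z)$, $v_n=v_n(y,z)$ be the Lucas sequences of the first and second kind. Let $x,r\in\mathbb{C}$ and let $c,n$ be integers with $n\ge c$; if $c<0$ assume moreover $r\neq 0$. Then \[ \sum_{k=c}^n(-1)^k x^{n-k}r^k\big(r v_{k+1}(y,z)+(xy+2rz)u_k(y,z)\big)=(-1)^n y\,r^{n+1}u_{n+1}(y,z)+(-1)^c r^c y\,x^{n-c+1}u_c(y,z) \] and \[ \sum_{k=c}^n(-1)^k x^{n-k}r^k\big((y^2-4z)r\,u_{k+1}(y,z)+(xy+2rz)v_k(y,z)\big)=(-1)^n y\,r^{n+1}v_{n+1}(y,z)+(-1)^c r^c y\,x^{n-c+1}v_c(y,z). \]
   Context: For nonzero complex numbers $y,z$, the Lucas sequences $u_n(y,z)$ and $v_n(y,z)$ are defined by $u_0=0$, $u_1=1$, $v_0=2$, $v_1=y$ and $w_n=y\,w_{n-1}-z\,w_{n-2}$ for $n\ge 2$ (for $w=u$ and $w=v$), and extended to negative indices by $u_{ -n}(y,z)=-u_n(y,z)/z^n$ and $v_{ -n}(y,z)=v_n(y,z)/z^n$. -}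

module Defs where

open import Algebra.Apartness.Bundles using (HeytingField; HeytingCommutativeRing)
open import Algebra.Bundles using (CommutativeRing)
open import Algebra.Definitions using (Invertible)
open import Data.Empty using (⊥-elim)
open import Data.Fin.Base using (Fin; toℕ)
import Data.Fin.Properties as Fin
open import Data.Integer.Base as ℤ using (ℤ; +_; -[1+_]; 0ℤ; 1ℤ)
import Data.Integer.Properties as ℤ
open import Data.Nat.Base as ℕ using (ℕ; zero; suc; _⊔_)
import Data.Nat.Properties as ℕ
open import Data.Product.Base using (∃-syntax; _×_; _,_; proj₁; proj₂)
open import Data.Rational.Base as ℚ using (ℚ; 0ℚ; 1ℚ; ½; ∣_∣; positive; nonNegative; >-nonZero)
import Data.Rational.Properties as ℚ
open import Data.Rational.Solver using (module +-*-Solver)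
open import Data.Sum.Base using (_⊎_; inj₁; inj₂; [_,_]′; map)
open import Function.Base using (_∘_)
open import Level using (0ℓ)
open import Relation.Binary.PropositionalEquality as ≡ using (_≡_)
open import Relation.Nullary using (¬_; Dec; yes; no)

module Estimates where

  open import Data.Rational.Base using (_+_; _*_; _-_; -_; _≤_; _<_)

  0<½ : 0ℚ < ½
  0<½ = ℚ.positive⁻¹ ½

  0<1 : 0ℚ < 1ℚ
  0<1 = ℚ.positive⁻¹ 1ℚ

  half : ∀ p → ½ * p + ½ * p ≡ p
  half p = ≡.trans (≡.sym (ℚ.*-distribʳ-+ p ½ ½)) (ℚ.*-identityˡ p)

  *-pos : ∀ {p q} → 0ℚ < p → 0ℚ < q → 0ℚ < p * q
  *-pos {p} {q} 0<p 0<q =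
    ℚ.positive⁻¹ (p * q) {{ℚ.pos*pos⇒pos p {{positive 0<p}} q {{positive 0<q}}}}

  ½-pos : ∀ {p} → 0ℚ < p → 0ℚ < ½ * p
  ½-pos = *-pos 0<½

  recip : ∀ {p} → 0ℚ < p → ∃[ q ] 0ℚ < q × p * q ≡ 1ℚ
  recip {p} 0<p =
    1/p , ℚ.positive⁻¹ 1/p {{ℚ.1/pos⇒pos p {{positive 0<p}}}} , ℚ.*-inverseʳ p {{>-nonZero 0<p}}
    where
    1/p : ℚ
    1/p = (ℚ.1/ p) {{>-nonZero 0<p}}

  divide : ∀ {p q} → 0ℚ < p → 0ℚ < q → ∃[ d ] 0ℚ < d × p * d ≡ q
  divide {p} {q} 0<p 0<q with recip 0<p
  ... | 1/p , 0<1/p , eq =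
    1/p * q , *-pos 0<1/p 0<q ,
    ≡.trans (≡.sym (ℚ.*-assoc p 1/p q)) (≡.trans (≡.cong (_* q) eq) (ℚ.*-identityˡ q))

  ∣p-p∣≡0 : ∀ p → ∣ p - p ∣ ≡ 0ℚ
  ∣p-p∣≡0 p = ≡.cong ∣_∣ (ℚ.+-inverseʳ p)

  ∣p-q∣≡∣q-p∣ : ∀ p q → ∣ p - q ∣ ≡ ∣ q - p ∣
  ∣p-q∣≡∣q-p∣ p q = ≡.trans (≡.cong ∣_∣ eq) (ℚ.∣-p∣≡∣p∣ (q - p))
    where
    open +-*-Solver
    eq : p - q ≡ - (q - p)
    eq = solve 2 (λ a b → a :- b := :- (b :- a)) ≡.refl p q

  triangle : ∀ p q r → ∣ p - r ∣ ≤ ∣ p - q ∣ + ∣ q - r ∣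
  triangle p q r = ≡.subst (λ t → ∣ t ∣ ≤ ∣ p - q ∣ + ∣ q - r ∣) eq (ℚ.∣p+q∣≤∣p∣+∣q∣ (p - q) (q - r))
    where
    open +-*-Solver
    eq : (p - q) + (q - r) ≡ p - r
    eq = solve 3 (λ a b c → (a :- b) :+ (b :- c) := a :- c) ≡.refl p q r

  triangle-< : ∀ p q r {ε} → ∣ p - q ∣ < ½ * ε → ∣ q - r ∣ < ½ * ε → ∣ p - r ∣ < ε
  triangle-< p q r {ε} a b =
    ℚ.≤-<-trans (triangle p q r) (≡.subst (_ <_) (half ε) (ℚ.+-mono-< a b))

  ∣p∣≤∣p-q∣+∣q∣ : ∀ p q → ∣ p ∣ ≤ ∣ p - q ∣ + ∣ q ∣
  ∣p∣≤∣p-q∣+∣q∣ p q = ≡.subst (λ t → ∣ t ∣ ≤ ∣ p - q ∣ + ∣ q ∣) eq (ℚ.∣p+q∣≤∣p∣+∣q∣ (p - q) q)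
    where
    open +-*-Solver
    eq : (p - q) + q ≡ p
    eq = solve 2 (λ a b → (a :- b) :+ b := a) ≡.refl p q

  +-cancelʳ-≤ : ∀ p q r → p + r ≤ q + r → p ≤ q
  +-cancelʳ-≤ p q r le = ≡.subst₂ _≤_ (eq p) (eq q) (ℚ.+-monoˡ-≤ (- r) le)
    where
    open +-*-Solver
    eq : ∀ t → t + r - r ≡ t
    eq t = solve 2 (λ a b → a :+ b :- b := a) ≡.refl t r

  -- If p is at least ε away from r, and q is within ½ε of r, then p is at
  -- least ½ε away from q.
  away : ∀ {ε} p q r → ε ≤ ∣ p - r ∣ → ∣ q - r ∣ < ½ * ε → ½ * ε ≤ ∣ p - q ∣
  away {ε} p q r ε≤ q-r< = +-cancelʳ-≤ _ _ (½ * ε) (begin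
    ½ * ε + ½ * ε           ≡⟨ half ε ⟩
    ε                       ≤⟨ ε≤ ⟩
    ∣ p - r ∣               ≤⟨ triangle p q r ⟩
    ∣ p - q ∣ + ∣ q - r ∣   ≤⟨ ℚ.+-monoʳ-≤ ∣ p - q ∣ (ℚ.<⇒≤ q-r<) ⟩
    ∣ p - q ∣ + ½ * ε       ∎)
    where open ℚ.≤-Reasoning

  far : ∀ {ε} p q → ½ * ε ≤ ∣ q ∣ → ∣ p - q ∣ < ½ * (½ * ε) → ½ * (½ * ε) ≤ ∣ p ∣
  far {ε} p q ≤q p-q< = ≡.subst (½ * (½ * ε) ≤_) (∣0-p∣≡∣p∣ p)
    (away 0ℚ p q (≡.subst (½ * ε ≤_) (≡.sym (∣0-p∣≡∣p∣ q)) ≤q) p-q<)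
    where
    ∣0-p∣≡∣p∣ : ∀ t → ∣ 0ℚ - t ∣ ≡ ∣ t ∣
    ∣0-p∣≡∣p∣ t = ≡.trans (≡.cong ∣_∣ (ℚ.+-identityˡ (- t))) (ℚ.∣-p∣≡∣p∣ t)

  near : ∀ {ε} p q → 0ℚ < ε → ∣ q ∣ < ½ * ε → ∣ p - q ∣ < ½ * (½ * ε) → ∣ p ∣ < ε
  near {ε} p q 0<ε q< p-q< = begin-strict
    ∣ p ∣                       ≤⟨ ∣p∣≤∣p-q∣+∣q∣ p q ⟩
    ∣ p - q ∣ + ∣ q ∣           <⟨ ℚ.+-mono-< p-q< q< ⟩
    ½ * (½ * ε) + ½ * ε         ≡⟨ ≡.cong (_+ ½ * ε) (ℚ.+-identityʳ (½ * (½ * ε))) ⟨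
    ½ * (½ * ε) + 0ℚ + ½ * ε    <⟨ ℚ.+-monoˡ-< (½ * ε) (ℚ.+-monoʳ-< (½ * (½ * ε)) (½-pos (½-pos 0<ε))) ⟩
    ½ * (½ * ε) + ½ * (½ * ε) + ½ * ε ≡⟨ ≡.cong (_+ ½ * ε) (half (½ * ε)) ⟩
    ½ * ε + ½ * ε               ≡⟨ half ε ⟩
    ε                           ∎
    where open ℚ.≤-Reasoning

  <+1 : ∀ {p} → 0ℚ ≤ p → 0ℚ < p + 1ℚ
  <+1 {p} 0≤p = ℚ.positive⁻¹ (p + 1ℚ) {{ℚ.nonNeg+pos⇒pos p {{nonNegative 0≤p}} 1ℚ}}

  ≤+1 : ∀ p q → ∣ p - q ∣ < 1ℚ → ∣ p ∣ ≤ ∣ q ∣ + 1ℚ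
  ≤+1 p q p-q<1 = ≡.subst (∣ p ∣ ≤_) (ℚ.+-comm 1ℚ ∣ q ∣)
    (ℚ.≤-trans (∣p∣≤∣p-q∣+∣q∣ p q) (ℚ.+-monoˡ-≤ ∣ q ∣ (ℚ.<⇒≤ p-q<1)))

  ∣p∣<½∧∣p-1∣<½⇒1<1 : ∀ p → ∣ p ∣ < ½ * 1ℚ → ∣ p - 1ℚ ∣ < ½ * 1ℚ → 1ℚ < 1ℚ
  ∣p∣<½∧∣p-1∣<½⇒1<1 p p< p-1< = triangle-< 1ℚ p 0ℚ {1ℚ}
    (≡.subst (_< ½ * 1ℚ) (∣p-q∣≡∣q-p∣ p 1ℚ) p-1<)
    (≡.subst (λ t → ∣ t ∣ < ½ * 1ℚ) (≡.sym (ℚ.+-identityʳ p)) p<)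

  ∣p*q∣<ε : ∀ {B d ε} p q → 0ℚ < B → B * d ≡ ε → ∣ p ∣ ≤ B → ∣ q ∣ < d → ∣ p * q ∣ < ε
  ∣p*q∣<ε {B} {d} {ε} p q 0<B eq p≤ q< = begin-strict
    ∣ p * q ∣       ≡⟨ ℚ.∣p*q∣≡∣p∣*∣q∣ p q ⟩
    ∣ p ∣ * ∣ q ∣   ≤⟨ ℚ.*-monoʳ-≤-nonNeg ∣ q ∣ {{ℚ.∣-∣-nonNeg q}} p≤ ⟩
    B * ∣ q ∣       <⟨ ℚ.*-monoʳ-<-pos B {{positive 0<B}} q< ⟩
    B * d           ≡⟨ eq ⟩
    ε               ∎
    where open ℚ.≤-Reasoning

  δ*ε≤∣p*q∣ : ∀ {δ ε} p q → 0ℚ < ε → δ ≤ ∣ p ∣ → ε ≤ ∣ q ∣ → δ * ε ≤ ∣ p * q ∣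
  δ*ε≤∣p*q∣ {δ} {ε} p q 0<ε δ≤ ε≤ = begin
    δ * ε           ≤⟨ ℚ.*-monoʳ-≤-nonNeg ε {{nonNegative (ℚ.<⇒≤ 0<ε)}} δ≤ ⟩
    ∣ p ∣ * ε       ≤⟨ ℚ.*-monoˡ-≤-nonNeg ∣ p ∣ {{ℚ.∣-∣-nonNeg p}} ε≤ ⟩
    ∣ p ∣ * ∣ q ∣   ≡⟨ ℚ.∣p*q∣≡∣p∣*∣q∣ p q ⟨
    ∣ p * q ∣       ∎
    where open ℚ.≤-Reasoning

  0≤p² : ∀ p → 0ℚ ≤ p * p
  0≤p² p with ℚ.≤-total 0ℚ p
  ... | inj₁ 0≤p = ℚ.nonNegative⁻¹ (p * p)
    {{ℚ.nonNeg*nonNeg⇒nonNeg p {{nonNegative 0≤p}} p {{nonNegative 0≤p}}}}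
  ... | inj₂ p≤0 = ℚ.nonNegative⁻¹ (p * p)
    {{ℚ.nonPos*nonPos⇒nonPos p {{ℚ.nonPositive p≤0}} p {{ℚ.nonPositive p≤0}}}}

  ∣p²∣≤∣p²+q²∣ : ∀ p q → ∣ p * p ∣ ≤ ∣ p * p + q * q ∣
  ∣p²∣≤∣p²+q²∣ p q = begin
    ∣ p * p ∣           ≡⟨ ℚ.0≤p⇒∣p∣≡p (0≤p² p) ⟩
    p * p               ≡⟨ ℚ.+-identityʳ (p * p) ⟨
    p * p + 0ℚ          ≤⟨ ℚ.+-monoʳ-≤ (p * p) (0≤p² q) ⟩
    p * p + q * q       ≡⟨ ℚ.0≤p⇒∣p∣≡p (ℚ.+-mono-≤ (0≤p² p) (0≤p² q)) ⟨
    ∣ p * p + q * q ∣   ∎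
    where open ℚ.≤-Reasoning

  -- The rational reciprocal made total by 0⁻¹ = 0.
  recip₀ : ℚ → ℚ
  recip₀ p with p ℚ.≟ 0ℚ
  ... | yes _  = 0ℚ
  ... | no p≢0 = (ℚ.1/ p) {{ℚ.≢-nonZero p≢0}}

  recip₀-inverse : ∀ {δ} p → 0ℚ < δ → δ ≤ ∣ p ∣ → recip₀ p * p ≡ 1ℚ
  recip₀-inverse p 0<δ δ≤ with p ℚ.≟ 0ℚ
  ... | yes ≡.refl = ⊥-elim (ℚ.<-irrefl ≡.refl (ℚ.<-≤-trans 0<δ δ≤))
  ... | no p≢0     = ℚ.*-inverseˡ p {{ℚ.≢-nonZero p≢0}}

  recip₀-close : ∀ {δ ε} p q → 0ℚ < δ → δ ≤ ∣ p ∣ → δ ≤ ∣ q ∣ →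
                 ∣ p - q ∣ < (δ * δ) * ε → ∣ recip₀ p - recip₀ q ∣ < ε
  recip₀-close {δ} {ε} p q 0<δ δ≤p δ≤q p-q< =
    ℚ.*-cancelˡ-<-nonNeg (δ * δ) {{nonNegative (ℚ.<⇒≤ (*-pos 0<δ 0<δ))}} (begin-strict
      δ * δ * d               ≤⟨ ℚ.*-monoʳ-≤-nonNeg d {{ℚ.∣-∣-nonNeg (p⁻¹ - q⁻¹)}} (δ*ε≤∣p*q∣ p q 0<δ δ≤p δ≤q) ⟩
      ∣ p * q ∣ * d           ≡⟨ ℚ.∣p*q∣≡∣p∣*∣q∣ (p * q) (p⁻¹ - q⁻¹) ⟨
      ∣ p * q * (p⁻¹ - q⁻¹) ∣ ≡⟨ ≡.cong ∣_∣ eq ⟩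
      ∣ q - p ∣               ≡⟨ ∣p-q∣≡∣q-p∣ q p ⟩
      ∣ p - q ∣               <⟨ p-q< ⟩
      δ * δ * ε               ∎)
    where
    open ℚ.≤-Reasoning
    p⁻¹ q⁻¹ d : ℚ
    p⁻¹ = recip₀ p
    q⁻¹ = recip₀ q
    d   = ∣ p⁻¹ - q⁻¹ ∣
    expand : p * q * (p⁻¹ - q⁻¹) ≡ (p⁻¹ * p) * q - (q⁻¹ * q) * p
    expand = solve 4 (λ a b c d → a :* b :* (c :- d) := (c :* a) :* b :- (d :* b) :* a) ≡.refl p q p⁻¹ q⁻¹
      where open +-*-Solver
    eq : p * q * (p⁻¹ - q⁻¹) ≡ q - p
    eq = ≡.trans expand (≡.cong₂ _-_
      (≡.trans (≡.cong (_* q) (recip₀-inverse p 0<δ δ≤p)) (ℚ.*-identityˡ q))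
      (≡.trans (≡.cong (_* p) (recip₀-inverse q 0<δ δ≤q)) (ℚ.*-identityˡ p)))

module Real where

  open Estimates

  Seq : Set
  Seq = ℕ → ℚ

  infix 4 _∼_

  -- f ∼ f says that f is a Cauchy sequence, and for Cauchy sequences f and g,
  -- f ∼ g says that they have the same limit.
  _∼_ : Seq → Seq → Set
  f ∼ g = ∀ ε → 0ℚ ℚ.< ε → ∃[ N ] (∀ m n → N ℕ.≤ m → N ℕ.≤ n → ∣ f m ℚ.- g n ∣ ℚ.< ε)

  record ℝ : Set where
    no-eta-equality
    constructor mkℝ
    field
      seq    : Seq
      cauchy : seq ∼ seq

  open ℝ public

  infix  4 _≈_ _#_
  infixl 6 _+_
  infixl 7 _*_
  infix  8 -_

  record _≈_ (x y : ℝ) : Set where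
    constructor same-limit
    field
      limits : seq x ∼ seq y

  open _≈_ public

  -- Apartness is the constructive form of x ≠ y: it is tight, and classically
  -- equivalent to ¬ (x ≈ y), but it alone suffices to construct inverses.
  record _#_ (x y : ℝ) : Set where
    constructor apart
    field
      separated : ∃[ δ ] 0ℚ ℚ.< δ × ∃[ N ] (∀ n → N ℕ.≤ n → δ ℚ.≤ ∣ seq x n ℚ.- seq y n ∣)

  both : ∀ {P Q R : ℕ → ℕ → Set} → (∀ m n → P m n → Q m n → R m n) →
         ∃[ N ] (∀ m n → N ℕ.≤ m → N ℕ.≤ n → P m n) →
         ∃[ N ] (∀ m n → N ℕ.≤ m → N ℕ.≤ n → Q m n) →
         ∃[ N ] (∀ m n → N ℕ.≤ m → N ℕ.≤ n → R m n)
  both f (M , p) (N , q) = M ⊔ N , λ m n a b →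
    f m n (p m n (ℕ.m⊔n≤o⇒m≤o M N a) (ℕ.m⊔n≤o⇒m≤o M N b))
          (q m n (ℕ.m⊔n≤o⇒n≤o M N a) (ℕ.m⊔n≤o⇒n≤o M N b))

  both₁ : ∀ {P Q R : ℕ → Set} → (∀ n → P n → Q n → R n) →
          ∃[ N ] (∀ n → N ℕ.≤ n → P n) →
          ∃[ N ] (∀ n → N ℕ.≤ n → Q n) →
          ∃[ N ] (∀ n → N ℕ.≤ n → R n)
  both₁ f (M , p) (N , q) = M ⊔ N , λ n a →
    f n (p n (ℕ.m⊔n≤o⇒m≤o M N a)) (q n (ℕ.m⊔n≤o⇒n≤o M N a))

  diagonal : ∀ {P : ℕ → ℕ → Set} →
             ∃[ N ] (∀ m n → N ℕ.≤ m → N ℕ.≤ n → P m n) → ∃[ N ] (∀ n → N ℕ.≤ n → P n n)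
  diagonal (N , p) = N , λ n a → p n n a a

  left : ∀ {P : ℕ → Set} → ∃[ N ] (∀ n → N ℕ.≤ n → P n) →
         ∃[ N ] (∀ m n → N ℕ.≤ m → N ℕ.≤ n → P m)
  left (N , p) = N , λ m _ a _ → p m a

  right : ∀ {P : ℕ → Set} → ∃[ N ] (∀ n → N ℕ.≤ n → P n) →
          ∃[ N ] (∀ m n → N ℕ.≤ m → N ℕ.≤ n → P n)
  right (N , p) = N , λ _ n _ b → p n b

  ∼-sym : ∀ {f g} → f ∼ g → g ∼ f
  ∼-sym {f} {g} f∼g ε 0<ε with f∼g ε 0<ε
  ... | N , p = N , λ m n a b → ≡.subst (ℚ._< ε) (∣p-q∣≡∣q-p∣ (f n) (g m)) (p n m b a)

  ∼-trans : ∀ {f g h} → f ∼ g → g ∼ h → f ∼ h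
  ∼-trans {f} {g} {h} f∼g g∼h ε 0<ε with f∼g (½ ℚ.* ε) (½-pos 0<ε) | g∼h (½ ℚ.* ε) (½-pos 0<ε)
  ... | M , p | N , q = M ⊔ N , λ m n a b →
    triangle-< (f m) (g (M ⊔ N)) (h n)
      (p m (M ⊔ N) (ℕ.m⊔n≤o⇒m≤o M N a) (ℕ.m≤m⊔n M N))
      (q (M ⊔ N) n (ℕ.m≤n⊔m M N) (ℕ.m⊔n≤o⇒n≤o M N b))

  ∼-respʳ : ∀ {f g h} → ∃[ N ] (∀ n → N ℕ.≤ n → g n ≡ h n) → f ∼ g → f ∼ h
  ∼-respʳ {f} eq f∼g ε 0<ε =
    both (λ m n e lt → ≡.subst (λ t → ∣ f m ℚ.- t ∣ ℚ.< ε) e lt) (right eq) (f∼g ε 0<ε)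

  eventually : ∀ x y → ∃[ N ] (∀ n → N ℕ.≤ n → seq x n ≡ seq y n) → x ≈ y
  eventually x y eq = same-limit (∼-respʳ {seq x} {seq x} {seq y} eq (cauchy x))

  pointwise : ∀ x y → (∀ n → seq x n ≡ seq y n) → x ≈ y
  pointwise x y eq = eventually x y (0 , λ n _ → eq n)

  const : ℚ → ℝ
  const p = mkℝ (λ _ → p) λ ε 0<ε → 0 , λ _ _ _ _ → ≡.subst (ℚ._< ε) (≡.sym (∣p-p∣≡0 p)) 0<ε

  0ʳ 1ʳ : ℝ
  0ʳ = const 0ℚ
  1ʳ = const 1ℚ

  -- Kept abstract so that comparing reals never unfolds convergence proofs.
  abstract

    +-resp : ∀ {f f′ g g′} → f ∼ f′ → g ∼ g′ → (λ n → f n ℚ.+ g n) ∼ (λ n → f′ n ℚ.+ g′ n)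
    +-resp {f} {f′} {g} {g′} f∼ g∼ ε 0<ε =
      both (λ m n a b → ℚ.≤-<-trans (le m n) (≡.subst (_ ℚ.<_) (half ε) (ℚ.+-mono-< a b)))
        (f∼ (½ ℚ.* ε) (½-pos 0<ε)) (g∼ (½ ℚ.* ε) (½-pos 0<ε))
      where
      open +-*-Solver
      eq : ∀ a b c d → (a ℚ.- c) ℚ.+ (b ℚ.- d) ≡ (a ℚ.+ b) ℚ.- (c ℚ.+ d)
      eq = solve 4 (λ a b c d → (a :- c) :+ (b :- d) := (a :+ b) :- (c :+ d)) ≡.refl
      le : ∀ m n → ∣ (f m ℚ.+ g m) ℚ.- (f′ n ℚ.+ g′ n) ∣ ℚ.≤ ∣ f m ℚ.- f′ n ∣ ℚ.+ ∣ g m ℚ.- g′ n ∣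
      le m n = ≡.subst (λ t → ∣ t ∣ ℚ.≤ ∣ f m ℚ.- f′ n ∣ ℚ.+ ∣ g m ℚ.- g′ n ∣) (eq (f m) (g m) (f′ n) (g′ n))
        (ℚ.∣p+q∣≤∣p∣+∣q∣ (f m ℚ.- f′ n) (g m ℚ.- g′ n))

    neg-resp : ∀ {f g} → f ∼ g → (λ n → ℚ.- f n) ∼ (λ n → ℚ.- g n)
    neg-resp {f} {g} f∼g ε 0<ε with f∼g ε 0<ε
    ... | N , p = N , λ m n a b → ≡.subst (ℚ._< ε) (eq m n) (p m n a b)
      where
      open +-*-Solver
      eq : ∀ m n → ∣ f m ℚ.- g n ∣ ≡ ∣ ℚ.- f m ℚ.- ℚ.- g n ∣
      eq m n = ≡.trans (∣p-q∣≡∣q-p∣ (f m) (g n)) (≡.cong ∣_∣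
        (solve 2 (λ a b → b :- a := :- a :- :- b) ≡.refl (f m) (g n)))

    bounded : ∀ {f g} → f ∼ g → ∃[ B ] 0ℚ ℚ.< B × ∃[ N ] (∀ n → N ℕ.≤ n → ∣ f n ∣ ℚ.≤ B)
    bounded {f} {g} f∼g = ∣ g N ∣ ℚ.+ 1ℚ , 0<B , N , bound
      where
      N : ℕ
      N = proj₁ (f∼g 1ℚ 0<1)
      0<B : 0ℚ ℚ.< ∣ g N ∣ ℚ.+ 1ℚ
      0<B = <+1 (ℚ.0≤∣p∣ (g N))
      bound : ∀ n → N ℕ.≤ n → ∣ f n ∣ ℚ.≤ ∣ g N ∣ ℚ.+ 1ℚ
      bound n a = ≤+1 (f n) (g N) (proj₂ (f∼g 1ℚ 0<1) n N a ℕ.≤-refl)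

    *-resp : ∀ {f f′ g g′} → f ∼ f′ → g ∼ g′ → (λ n → f n ℚ.* g n) ∼ (λ n → f′ n ℚ.* g′ n)
    *-resp {f} {f′} {g} {g′} f∼ g∼ ε 0<ε =
      both (λ m n a b → ℚ.≤-<-trans (le m n) (≡.subst (_ ℚ.<_) (half ε) (ℚ.+-mono-< a b)))
        (bounded*small (bounded {f} {f′} f∼))
        (small*bounded (bounded {g′} {g} (∼-sym {g} {g′} g∼)))
      where
      open +-*-Solver
      eq : ∀ a b c d → a ℚ.* (b ℚ.- d) ℚ.+ d ℚ.* (a ℚ.- c) ≡ (a ℚ.* b) ℚ.- (c ℚ.* d)
      eq = solve 4 (λ a b c d → a :* (b :- d) :+ d :* (a :- c) := (a :* b) :- (c :* d)) ≡.refl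
      le : ∀ m n → ∣ (f m ℚ.* g m) ℚ.- (f′ n ℚ.* g′ n) ∣ ℚ.≤
                   ∣ f m ℚ.* (g m ℚ.- g′ n) ∣ ℚ.+ ∣ g′ n ℚ.* (f m ℚ.- f′ n) ∣
      le m n = ≡.subst (λ t → ∣ t ∣ ℚ.≤ ∣ f m ℚ.* (g m ℚ.- g′ n) ∣ ℚ.+ ∣ g′ n ℚ.* (f m ℚ.- f′ n) ∣)
        (eq (f m) (g m) (f′ n) (g′ n))
        (ℚ.∣p+q∣≤∣p∣+∣q∣ (f m ℚ.* (g m ℚ.- g′ n)) (g′ n ℚ.* (f m ℚ.- f′ n)))
      bounded*small : ∃[ B ] 0ℚ ℚ.< B × ∃[ N ] (∀ n → N ℕ.≤ n → ∣ f n ∣ ℚ.≤ B) →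
        ∃[ N ] (∀ m n → N ℕ.≤ m → N ℕ.≤ n → ∣ f m ℚ.* (g m ℚ.- g′ n) ∣ ℚ.< ½ ℚ.* ε)
      bounded*small (B , 0<B , f≤B) =
        both (λ m n → ∣p*q∣<ε (f m) (g m ℚ.- g′ n) 0<B (proj₂ (proj₂ D))) (left f≤B) (g∼ (proj₁ D) (proj₁ (proj₂ D)))
        where
        D : ∃[ d ] 0ℚ ℚ.< d × B ℚ.* d ≡ ½ ℚ.* ε
        D = divide 0<B (½-pos 0<ε)
      small*bounded : ∃[ B ] 0ℚ ℚ.< B × ∃[ N ] (∀ n → N ℕ.≤ n → ∣ g′ n ∣ ℚ.≤ B) →
        ∃[ N ] (∀ m n → N ℕ.≤ m → N ℕ.≤ n → ∣ g′ n ℚ.* (f m ℚ.- f′ n) ∣ ℚ.< ½ ℚ.* ε)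
      small*bounded (B , 0<B , g′≤B) =
        both (λ m n → ∣p*q∣<ε (g′ n) (f m ℚ.- f′ n) 0<B (proj₂ (proj₂ D))) (right g′≤B) (f∼ (proj₁ D) (proj₁ (proj₂ D)))
        where
        D : ∃[ d ] 0ℚ ℚ.< d × B ℚ.* d ≡ ½ ℚ.* ε
        D = divide 0<B (½-pos 0<ε)

  _+_ _*_ : ℝ → ℝ → ℝ
  x + y = mkℝ (λ n → seq x n ℚ.+ seq y n)
              (+-resp {seq x} {seq x} {seq y} {seq y} (cauchy x) (cauchy y))
  x * y = mkℝ (λ n → seq x n ℚ.* seq y n)
              (*-resp {seq x} {seq x} {seq y} {seq y} (cauchy x) (cauchy y))

  -_ : ℝ → ℝ
  - x = mkℝ (λ n → ℚ.- seq x n) (neg-resp {seq x} {seq x} (cauchy x))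

  commutativeRing : CommutativeRing 0ℓ 0ℓ
  commutativeRing = record
    { Carrier = ℝ
    ; _≈_ = _≈_
    ; _+_ = _+_
    ; _*_ = _*_
    ; -_  = -_
    ; 0#  = 0ʳ
    ; 1#  = 1ʳ
    ; isCommutativeRing = record
      { isRing = record
        { +-isAbelianGroup = record
          { isGroup = record
            { isMonoid = record
              { isSemigroup = record
                { isMagma = record
                  { isEquivalence = record
                    { refl  = λ {x} → same-limit (cauchy x)
                    ; sym   = λ { {x} {y} (same-limit p) → same-limit (∼-sym {seq x} {seq y} p) }
                    ; trans = λ { {x} {y} {z} (same-limit p) (same-limit q) → same-limit (∼-trans {seq x} {seq y} {seq z} p q) }
                    }
                  ; ∙-cong = λ { {x} {x′} {y} {y′} (same-limit p) (same-limit q) → same-limit (+-resp {seq x} {seq x′} {seq y} {seq y′} p q) }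
                  }
                ; assoc = λ x y z → pointwise (x + y + z) (x + (y + z))
                    λ n → ℚ.+-assoc (seq x n) (seq y n) (seq z n)
                }
              ; identity = (λ x → pointwise (0ʳ + x) x λ n → ℚ.+-identityˡ (seq x n))
                         , (λ x → pointwise (x + 0ʳ) x λ n → ℚ.+-identityʳ (seq x n))
              }
            ; inverse = (λ x → pointwise (- x + x) 0ʳ λ n → ℚ.+-inverseˡ (seq x n))
                      , (λ x → pointwise (x + - x) 0ʳ λ n → ℚ.+-inverseʳ (seq x n))
            ; ⁻¹-cong = λ { {x} {y} (same-limit p) → same-limit (neg-resp {seq x} {seq y} p) }
            }
          ; comm = λ x y → pointwise (x + y) (y + x) λ n → ℚ.+-comm (seq x n) (seq y n)
          }
        ; *-cong = λ { {x} {x′} {y} {y′} (same-limit p) (same-limit q) → same-limit (*-resp {seq x} {seq x′} {seq y} {seq y′} p q) }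
        ; *-assoc = λ x y z → pointwise (x * y * z) (x * (y * z))
            λ n → ℚ.*-assoc (seq x n) (seq y n) (seq z n)
        ; *-identity = (λ x → pointwise (1ʳ * x) x λ n → ℚ.*-identityˡ (seq x n))
                     , (λ x → pointwise (x * 1ʳ) x λ n → ℚ.*-identityʳ (seq x n))
        ; distrib = (λ x y z → pointwise (x * (y + z)) (x * y + x * z)
                      λ n → ℚ.*-distribˡ-+ (seq x n) (seq y n) (seq z n))
                  , (λ x y z → pointwise ((y + z) * x) (y * x + z * x)
                      λ n → ℚ.*-distribʳ-+ (seq x n) (seq y n) (seq z n))
        }
      ; *-comm = λ x y → pointwise (x * y) (y * x) λ n → ℚ.*-comm (seq x n) (seq y n)
      }
    }

  #-irrefl : ∀ {x y} → x ≈ y → ¬ (x # y)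
  #-irrefl x≈y (apart (δ , 0<δ , N , p)) with limits x≈y δ 0<δ
  ... | M , q = ℚ.<-irrefl ≡.refl (ℚ.≤-<-trans
    (p (M ⊔ N) (ℕ.m≤n⊔m M N)) (q (M ⊔ N) (M ⊔ N) (ℕ.m≤m⊔n M N) (ℕ.m≤m⊔n M N)))

  #-sym : ∀ {x y} → x # y → y # x
  #-sym {x} {y} (apart (δ , 0<δ , N , p)) =
    apart (δ , 0<δ , N , λ n a → ≡.subst (δ ℚ.≤_) (∣p-q∣≡∣q-p∣ (seq x n) (seq y n)) (p n a))

  locate : ∀ x y {ε} → 0ℚ ℚ.< ε →
           (x # y) ⊎ ∃[ N ] (∀ n → N ℕ.≤ n → ∣ seq x n ℚ.- seq y n ∣ ℚ.< ε)
  locate x y {ε} 0<ε = decide (½ ℚ.* ε ℚ.≤? ∣ d N ∣)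
    where
    d : Seq
    d n = seq x n ℚ.- seq y n
    settled : ∃[ N ] (∀ m n → N ℕ.≤ m → N ℕ.≤ n → ∣ d m ℚ.- d n ∣ ℚ.< ½ ℚ.* (½ ℚ.* ε))
    settled = cauchy (x + - y) (½ ℚ.* (½ ℚ.* ε)) (½-pos (½-pos 0<ε))
    N : ℕ
    N = proj₁ settled
    close : ∀ n → N ℕ.≤ n → ∣ d n ℚ.- d N ∣ ℚ.< ½ ℚ.* (½ ℚ.* ε)
    close n a = proj₂ settled n N a ℕ.≤-refl
    decide : Dec (½ ℚ.* ε ℚ.≤ ∣ d N ∣) →
             (x # y) ⊎ ∃[ N ] (∀ n → N ℕ.≤ n → ∣ d n ∣ ℚ.< ε)
    decide (yes ≤d) = inj₁ (apart (½ ℚ.* (½ ℚ.* ε) , ½-pos (½-pos 0<ε) , N , λ n a →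
      far {ε} (d n) (d N) ≤d (close n a)))
    decide (no ≰d)  = inj₂ (N , λ n a → near {ε} (d n) (d N) 0<ε (ℚ.≰⇒> ≰d) (close n a))

  #-cotrans : ∀ {x y} → x # y → ∀ z → (x # z) ⊎ (z # y)
  #-cotrans {x} {y} (apart (δ , 0<δ , x#y)) z = [ inj₂ , inj₁ ∘ x#z ]′ (locate z y (½-pos 0<δ))
    where
    x#z : ∃[ N ] (∀ n → N ℕ.≤ n → ∣ seq z n ℚ.- seq y n ∣ ℚ.< ½ ℚ.* δ) → x # z
    x#z z≈y = apart (½ ℚ.* δ , ½-pos 0<δ ,
      both₁ (λ n → away {δ} (seq x n) (seq z n) (seq y n)) x#y z≈y)

  #-tight : ∀ x y → ¬ (x # y) → x ≈ y
  #-tight x y ¬x#y = same-limit λ ε 0<ε → [ ⊥-elim ∘ ¬x#y , x≈y ε 0<ε ]′ (locate x y (½-pos 0<ε))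
    where
    x≈y : ∀ ε → 0ℚ ℚ.< ε → ∃[ N ] (∀ n → N ℕ.≤ n → ∣ seq x n ℚ.- seq y n ∣ ℚ.< ½ ℚ.* ε) →
          ∃[ N ] (∀ m n → N ℕ.≤ m → N ℕ.≤ n → ∣ seq x m ℚ.- seq y n ∣ ℚ.< ε)
    x≈y ε 0<ε near = both (λ m n → triangle-< (seq x m) (seq y m) (seq y n) {ε})
      (left near) (cauchy y (½ ℚ.* ε) (½-pos 0<ε))

  #⇒invertible : ∀ {x y} → x # y → Invertible _≈_ 1ʳ _*_ (x + - y)
  #⇒invertible {x} {y} (apart (δ , 0<δ , N , δ≤)) = w⁻¹ , inverse , R.trans (R.*-comm (x + - y) w⁻¹) inverse
    where
    module R = CommutativeRing commutativeRing
    d f : Seq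
    d = seq (x + - y)
    f n = recip₀ (d n)
    f∼f : f ∼ f
    f∼f ε 0<ε = both (λ { m n (a , b) → recip₀-close {δ} {ε} (d m) (d n) 0<δ a b })
      (N , λ m n a b → δ≤ m a , δ≤ n b)
      (cauchy (x + - y) (δ ℚ.* δ ℚ.* ε) (*-pos (*-pos 0<δ 0<δ) 0<ε))
    w⁻¹ : ℝ
    w⁻¹ = mkℝ f f∼f
    inverse : w⁻¹ * (x + - y) ≈ 1ʳ
    inverse = eventually (w⁻¹ * (x + - y)) 1ʳ (N , λ n a → recip₀-inverse {δ} (d n) 0<δ (δ≤ n a))

  invertible⇒# : ∀ {x y} → Invertible _≈_ 1ʳ _*_ (x + - y) → x # y
  invertible⇒# {x} {y} (v , v*w≈1 , _) = [ (λ x#y → x#y) , ⊥-elim ∘ absurd ]′ (locate x y 0<δ)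
    where
    w : ℝ
    w = x + - y
    bound : ∃[ B ] 0ℚ ℚ.< B × ∃[ N ] (∀ n → N ℕ.≤ n → ∣ seq v n ∣ ℚ.≤ B)
    bound = bounded {seq v} {seq v} (cauchy v)
    B : ℚ
    B = proj₁ bound
    0<B : 0ℚ ℚ.< B
    0<B = proj₁ (proj₂ bound)
    quotient : ∃[ δ ] 0ℚ ℚ.< δ × B ℚ.* δ ≡ ½ ℚ.* 1ℚ
    quotient = divide 0<B (½-pos 0<1)
    δ : ℚ
    δ = proj₁ quotient
    0<δ : 0ℚ ℚ.< δ
    0<δ = proj₁ (proj₂ quotient)
    absurd : ¬ (∃[ N ] (∀ n → N ℕ.≤ n → ∣ seq w n ∣ ℚ.< δ))
    absurd w<δ = ℚ.<-irrefl ≡.refl (proj₂ 1<1 (proj₁ 1<1) ℕ.≤-refl)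
      where
      1<1 : ∃[ N ] (∀ n → N ℕ.≤ n → 1ℚ ℚ.< 1ℚ)
      1<1 = both₁ (λ n → ∣p∣<½∧∣p-1∣<½⇒1<1 (seq v n ℚ.* seq w n))
        (both₁ (λ n → ∣p*q∣<ε (seq v n) (seq w n) 0<B (proj₂ (proj₂ quotient))) (proj₂ (proj₂ bound)) w<δ)
        (diagonal (limits v*w≈1 (½ ℚ.* 1ℚ) (½-pos 0<1)))

  heytingField : HeytingField 0ℓ 0ℓ 0ℓ
  heytingField = record
    { isHeytingField = record
      { isHeytingCommutativeRing = record
        { isCommutativeRing = CommutativeRing.isCommutativeRing commutativeRing
        ; isApartnessRelation = record
          { irrefl  = λ {x} {y} → #-irrefl {x} {y}
          ; sym     = λ {x} {y} → #-sym {x} {y}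
          ; cotrans = λ {x} {y} → #-cotrans {x} {y}
          }
        ; #⇒invertible = λ {x} {y} → #⇒invertible {x} {y}
        ; invertible⇒# = λ {x} {y} → invertible⇒# {x} {y}
        }
      ; tight = λ x y → #-tight x y , #-irrefl {x} {y}
      }
    }

  x#0⇒x²+y²#0 : ∀ x y → x # 0ʳ → x * x + y * y # 0ʳ
  x#0⇒x²+y²#0 x y (apart (δ , 0<δ , N , p)) = apart (δ ℚ.* δ , *-pos 0<δ 0<δ , N , λ n a →
    ≡.subst (λ t → δ ℚ.* δ ℚ.≤ ∣ t ∣) (≡.sym (ℚ.+-identityʳ _))
      (ℚ.≤-trans (δ*ε≤∣p*q∣ (seq x n) (seq x n) 0<δ (at n a) (at n a)) (∣p²∣≤∣p²+q²∣ (seq x n) (seq y n))))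
    where
    at : ∀ n → N ℕ.≤ n → δ ℚ.≤ ∣ seq x n ∣
    at n a = ≡.subst (λ t → δ ℚ.≤ ∣ t ∣) (ℚ.+-identityʳ (seq x n)) (p n a)

module HeytingProperties (H : HeytingCommutativeRing 0ℓ 0ℓ 0ℓ) where

  open HeytingCommutativeRing H
  open import Algebra.Apartness.Properties.HeytingCommutativeRing H public
  open import Relation.Binary.Reasoning.Setoid (CommutativeRing.setoid commutativeRing)

  x-y#0 : ∀ {x y} → x # y → x + - y # 0#
  x-y#0 {x} {y} x#y with #⇒invertible x#y
  ... | u , u*[x-y]≈1 , _ = invertibleˡ⇒# (u , trans (*-congˡ (x-0≈x (x - y))) u*[x-y]≈1)

  x+y#0 : ∀ x y → x + y # 0# → x # 0# ⊎ y # 0#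
  x+y#0 x y x+y#0 = map (λ x+y#y → #-congʳ x+y-y≈x (x-y#0 x+y#y)) (λ y#0 → y#0) (#-cotrans x+y#0 y)
    where
    x+y-y≈x : x + y + - y ≈ x
    x+y-y≈x = begin
      x + y + - y    ≈⟨ +-assoc x y (- y) ⟩
      x + (y + - y)  ≈⟨ +-congˡ (-‿inverseʳ y) ⟩
      x + 0#         ≈⟨ +-identityʳ x ⟩
      x              ∎

  factor : ∀ x y c → c * (x + - y) # 0# → x # y
  factor x y c cd#0 with #⇒invertible cd#0
  ... | u , u*cd≈1 , _ = invertibleˡ⇒# (u * c , (begin
    u * c * (x + - y)         ≈⟨ *-assoc u c (x + - y) ⟩
    u * (c * (x + - y))       ≈⟨ *-congˡ (x-0≈x (c * (x + - y))) ⟨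
    u * (c * (x + - y) - 0#)  ≈⟨ u*cd≈1 ⟩
    1#                        ∎))

module Complex where

  open Real using (ℝ; seq; 0ʳ; 1ʳ; pointwise)
  open HeytingField Real.heytingField using (heytingCommutativeRing)
  open HeytingProperties heytingCommutativeRing using (1#0; #-congʳ; x-y#0; x+y#0; factor)

  private module R where
    open HeytingCommutativeRing heytingCommutativeRing public

  infix 4 _≈_ _#_
  infixl 6 _+_
  infixl 7 _*_
  infix  8 -_

  record ℂ : Set where
    no-eta-equality
    constructor _+i_
    field
      re im : ℝ

  open ℂ public

  record _≈_ (z w : ℂ) : Set where
    constructor _,_
    field
      re≈ : re z R.≈ re w
      im≈ : im z R.≈ im w

  open _≈_ public

  _#_ : ℂ → ℂ → Set
  z # w = (re z R.# re w) ⊎ (im z R.# im w)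

  0ᶜ 1ᶜ : ℂ
  0ᶜ = 0ʳ +i 0ʳ
  1ᶜ = 1ʳ +i 0ʳ

  _+_ _*_ : ℂ → ℂ → ℂ
  z + w = (re z R.+ re w) +i (im z R.+ im w)
  z * w = (re z R.* re w R.+ R.- (im z R.* im w)) +i (re z R.* im w R.+ im z R.* re w)

  -_ : ℂ → ℂ
  - z = (R.- re z) +i (R.- im z)

  *-comm : ∀ z w → z * w ≈ w * z
  *-comm z w =
    R.+-cong (R.*-comm (re z) (re w)) (R.-‿cong (R.*-comm (im z) (im w))) ,
    R.trans (R.+-comm (re z R.* im w) (im z R.* re w))
      (R.+-cong (R.*-comm (im z) (re w)) (R.*-comm (re z) (im w)))

  *-assoc : ∀ z w v → z * w * v ≈ z * (w * v)
  *-assoc z w v =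
    pointwise (re (z * w * v)) (re (z * (w * v)))
      (λ n → solve 6 (λ a b c d e f →
        (a :* c :+ :- (b :* d)) :* e :+ :- ((a :* d :+ b :* c) :* f) :=
        a :* (c :* e :+ :- (d :* f)) :+ :- (b :* (c :* f :+ d :* e))) ≡.refl
        (seq (re z) n) (seq (im z) n) (seq (re w) n) (seq (im w) n) (seq (re v) n) (seq (im v) n)) ,
    pointwise (im (z * w * v)) (im (z * (w * v)))
      (λ n → solve 6 (λ a b c d e f →
        (a :* c :+ :- (b :* d)) :* f :+ (a :* d :+ b :* c) :* e :=
        a :* (c :* f :+ d :* e) :+ b :* (c :* e :+ :- (d :* f))) ≡.refl
        (seq (re z) n) (seq (im z) n) (seq (re w) n) (seq (im w) n) (seq (re v) n) (seq (im v) n))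
    where open +-*-Solver

  *-identityˡ : ∀ z → 1ᶜ * z ≈ z
  *-identityˡ z =
    pointwise (re (1ᶜ * z)) (re z)
      (λ n → solve 2 (λ a b → con 1ℚ :* a :+ :- (con 0ℚ :* b) := a) ≡.refl (seq (re z) n) (seq (im z) n)) ,
    pointwise (im (1ᶜ * z)) (im z)
      (λ n → solve 2 (λ a b → con 1ℚ :* b :+ con 0ℚ :* a := b) ≡.refl (seq (re z) n) (seq (im z) n))
    where open +-*-Solver

  *-distribʳ-+ : ∀ z w v → (w + v) * z ≈ w * z + v * z
  *-distribʳ-+ z w v =
    pointwise (re ((w + v) * z)) (re (w * z + v * z))
      (λ n → solve 6 (λ a b c d e f →
        (c :+ e) :* a :+ :- ((d :+ f) :* b) :=
        c :* a :+ :- (d :* b) :+ (e :* a :+ :- (f :* b))) ≡.refl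
        (seq (re z) n) (seq (im z) n) (seq (re w) n) (seq (im w) n) (seq (re v) n) (seq (im v) n)) ,
    pointwise (im ((w + v) * z)) (im (w * z + v * z))
      (λ n → solve 6 (λ a b c d e f →
        (c :+ e) :* b :+ (d :+ f) :* a :=
        c :* b :+ d :* a :+ (e :* b :+ f :* a)) ≡.refl
        (seq (re z) n) (seq (im z) n) (seq (re w) n) (seq (im w) n) (seq (re v) n) (seq (im v) n))
    where open +-*-Solver

  ≈-refl : ∀ {z} → z ≈ z
  ≈-refl = R.refl , R.refl

  ≈-sym : ∀ {z w} → z ≈ w → w ≈ z
  ≈-sym (p , q) = R.sym p , R.sym q

  ≈-trans : ∀ {z w v} → z ≈ w → w ≈ v → z ≈ v
  ≈-trans (p , q) (p′ , q′) = R.trans p p′ , R.trans q q′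

  +-cong : ∀ {z z′ w w′} → z ≈ z′ → w ≈ w′ → z + w ≈ z′ + w′
  +-cong (p , q) (p′ , q′) = R.+-cong p p′ , R.+-cong q q′

  *-cong : ∀ {z z′ w w′} → z ≈ z′ → w ≈ w′ → z * w ≈ z′ * w′
  *-cong (p , q) (p′ , q′) =
    R.+-cong (R.*-cong p p′) (R.-‿cong (R.*-cong q q′)) , R.+-cong (R.*-cong p q′) (R.*-cong q p′)

  *-distribˡ-+ : ∀ z w v → z * (w + v) ≈ z * w + z * v
  *-distribˡ-+ z w v = ≈-trans (*-comm z (w + v))
    (≈-trans (*-distribʳ-+ z w v) (+-cong (*-comm w z) (*-comm v z)))

  commutativeRing : CommutativeRing 0ℓ 0ℓ
  commutativeRing = record
    { Carrier = ℂ
    ; _≈_ = _≈_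
    ; _+_ = _+_
    ; _*_ = _*_
    ; -_  = -_
    ; 0#  = 0ᶜ
    ; 1#  = 1ᶜ
    ; isCommutativeRing = record
      { isRing = record
        { +-isAbelianGroup = record
          { isGroup = record
            { isMonoid = record
              { isSemigroup = record
                { isMagma = record
                  { isEquivalence = record { refl = ≈-refl ; sym = ≈-sym ; trans = ≈-trans }
                  ; ∙-cong = +-cong
                  }
                ; assoc = λ z w v → R.+-assoc (re z) (re w) (re v) , R.+-assoc (im z) (im w) (im v)
                }
              ; identity = (λ z → R.+-identityˡ (re z) , R.+-identityˡ (im z))
                         , (λ z → R.+-identityʳ (re z) , R.+-identityʳ (im z))
              }
            ; inverse = (λ z → R.-‿inverseˡ (re z) , R.-‿inverseˡ (im z))
                      , (λ z → R.-‿inverseʳ (re z) , R.-‿inverseʳ (im z))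
            ; ⁻¹-cong = λ { (p , q) → R.-‿cong p , R.-‿cong q }
            }
          ; comm = λ z w → R.+-comm (re z) (re w) , R.+-comm (im z) (im w)
          }
        ; *-cong = *-cong
        ; *-assoc = *-assoc
        ; *-identity = *-identityˡ , λ z → ≈-trans (*-comm z 1ᶜ) (*-identityˡ z)
        ; distrib = *-distribˡ-+ , *-distribʳ-+
        }
      ; *-comm = *-comm
      }
    }

  #-cotrans : ∀ {z w} → z # w → ∀ v → (z # v) ⊎ (v # w)
  #-cotrans (inj₁ p) v = map inj₁ inj₁ (R.#-cotrans p (re v))
  #-cotrans (inj₂ p) v = map inj₂ inj₂ (R.#-cotrans p (im v))

  #-irrefl : ∀ {z w} → z ≈ w → ¬ (z # w)
  #-irrefl (p , _) (inj₁ a) = R.#-irrefl p a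
  #-irrefl (_ , q) (inj₂ b) = R.#-irrefl q b

  #⇒invertible : ∀ {z w} → z # w → Invertible _≈_ 1ᶜ _*_ (z + - w)
  #⇒invertible {z} {w} z#w = v , v*d≈1 , ≈-trans (*-comm d v) v*d≈1
    where
    open +-*-Solver
    a b N : ℝ
    a = re z R.+ R.- re w
    b = im z R.+ R.- im w
    N = a R.* a R.+ b R.* b
    N#0 : N R.# 0ʳ
    N#0 = [ (λ p → Real.x#0⇒x²+y²#0 a b (x-y#0 p))
          , (λ q → #-congʳ (R.+-comm (b R.* b) (a R.* a)) (Real.x#0⇒x²+y²#0 b a (x-y#0 q)))
          ]′ z#w
    1/N : Invertible R._≈_ 1ʳ R._*_ (N R.+ R.- 0ʳ)
    1/N = R.#⇒invertible N#0
    u : ℝ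
    u = proj₁ 1/N
    d v : ℂ
    d = z + - w
    v = (a R.* u) +i (R.- (b R.* u))
    v*d≈1 : v * d ≈ 1ᶜ
    v*d≈1 =
      R.trans (pointwise (re (v * d)) (u R.* (a R.* a R.+ b R.* b R.+ R.- 0ʳ))
        (λ n → solve 3 (λ a b u →
          (a :* u) :* a :+ :- ((:- (b :* u)) :* b) := u :* (a :* a :+ b :* b :+ :- con 0ℚ)) ≡.refl
          (seq a n) (seq b n) (seq u n)))
        (proj₁ (proj₂ 1/N)) ,
      pointwise (im (v * d)) 0ʳ
        (λ n → solve 3 (λ a b u → (a :* u) :* b :+ (:- (b :* u)) :* a := con 0ℚ) ≡.refl
          (seq a n) (seq b n) (seq u n))

  invertible⇒# : ∀ {z w} → Invertible _≈_ 1ᶜ _*_ (z + - w) → z # w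
  invertible⇒# {z} {w} (v , v*d≈1 , _) = map (factor (re z) (re w) (re v))
    (factor (im z) (im w) (R.- im v) ∘ #-congʳ neg)
    (x+y#0 (re v R.* (re z R.+ R.- re w)) (R.- (im v R.* (im z R.+ R.- im w)))
      (#-congʳ (R.sym (re≈ v*d≈1)) 1#0))
    where
    open +-*-Solver
    b : ℝ
    b = im z R.+ R.- im w
    neg : R.- (im v R.* b) R.≈ R.- im v R.* b
    neg = pointwise (R.- (im v R.* b)) (R.- im v R.* b)
      (λ n → solve 2 (λ c b → :- (c :* b) := (:- c) :* b) ≡.refl (seq (im v) n) (seq b n))

  heytingField : HeytingField 0ℓ 0ℓ 0ℓ
  heytingField = record
    { isHeytingField = record
      { isHeytingCommutativeRing = record
        { isCommutativeRing = CommutativeRing.isCommutativeRing commutativeRing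
        ; isApartnessRelation = record
          { irrefl  = #-irrefl
          ; sym     = λ {z} {w} → map (R.#-sym {re z} {re w}) (R.#-sym {im z} {im w})
          ; cotrans = λ {z} {w} → #-cotrans {z} {w}
          }
        ; #⇒invertible = λ {z} {w} → #⇒invertible {z} {w}
        ; invertible⇒# = λ {z} {w} → invertible⇒# {z} {w}
        }
      ; tight = λ z w → (λ ¬z#w → Real.#-tight (re z) (re w) (¬z#w ∘ inj₁) ,
                                  Real.#-tight (im z) (im w) (¬z#w ∘ inj₂))
                      , #-irrefl
      }
    }

module LucasSequences {c ℓ₁ ℓ₂} (F : HeytingField c ℓ₁ ℓ₂) where

  open HeytingField F hiding (_≈_; _#_; _+_; _*_; -_; _-_; 0#; 1#)
  open HeytingField F public using (_≈_; _#_; _+_; _*_; -_; _-_; 0#; 1#)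
  open HeytingCommutativeRing heytingCommutativeRing using (commutativeRing)
  open CommutativeRing commutativeRing using (ring; semiring; +-commutativeMonoid)
  open import Algebra.Apartness.Properties.HeytingCommutativeRing heytingCommutativeRing
    using (invertibleˡ⇒#; x-0≈x; 1#0; x#0y#0→xy#0)
  open import Algebra.Properties.CommutativeMonoid.Sum +-commutativeMonoid using (sum)
  open import Algebra.Properties.Ring ring using (-1*x≈-x; -‿involutive)
  open import Algebra.Properties.Semiring.Exp semiring public using (_^_)

  infixl 7 _/_⟨_⟩
  infixl 8 _^ℤ_⟨_⟩
  infix  8 -1^_

  2# 4# : Carrier
  2# = 1# + 1#
  4# = 2# + 2#

  -- #⇒invertible inverts the difference x - 0#, which equals x.
  inverse : ∀ x → x # 0# → Carrier
  inverse x x#0 = proj₁ (#⇒invertible x#0)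

  _/_⟨_⟩ : ∀ x y → y # 0# → Carrier
  x / y ⟨ y#0 ⟩ = x * inverse y y#0

  -- The base has to be nonzero only when the exponent is negative; in
  -- particular 0⁰ = 1.
  _^ℤ_⟨_⟩ : ∀ x k → (k ℤ.< 0ℤ → x # 0#) → Carrier
  x ^ℤ + n      ⟨ _   ⟩ = x ^ n
  x ^ℤ -[1+ n ] ⟨ x#0 ⟩ = inverse x (x#0 ℤ.-<+) ^ suc n

  ^-#0 : ∀ {x} → x # 0# → ∀ n → x ^ n # 0#
  ^-#0 x#0 zero    = 1#0
  ^-#0 x#0 (suc n) = x#0y#0→xy#0 x#0 (^-#0 x#0 n)

  -1#0 : - 1# # 0#
  -1#0 = invertibleˡ⇒# (- 1# , trans (*-congˡ (x-0≈x (- 1#))) (trans (-1*x≈-x (- 1#)) (-‿involutive 1#)))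

  -1^_ : ℤ → Carrier
  -1^ k = (- 1#) ^ℤ k ⟨ (λ _ → -1#0) ⟩

  -- The sum of f k over all integers k with a ≤ k ≤ b.
  ∑ℤ : ∀ a b → a ℤ.≤ b → (∀ k → a ℤ.≤ k → k ℤ.≤ b → Carrier) → Carrier
  ∑ℤ a b a≤b f = sum {suc ℤ.∣ b ℤ.- a ∣} λ i →
    f (a ℤ.+ + toℕ i) (ℤ.i≤i+j a (+ toℕ i)) (upper i)
    where
    upper : (i : Fin (suc ℤ.∣ b ℤ.- a ∣)) → a ℤ.+ + toℕ i ℤ.≤ b
    upper i = begin
      a ℤ.+ + toℕ i            ≤⟨ ℤ.+-monoʳ-≤ a (ℤ.+≤+ (Fin.toℕ≤pred[n] i)) ⟩
      a ℤ.+ + ℤ.∣ b ℤ.- a ∣    ≡⟨ ≡.cong (λ t → a ℤ.+ t) (ℤ.0≤i⇒+∣i∣≡i (ℤ.i≤j⇒0≤j-i a≤b)) ⟩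
      a ℤ.+ (b ℤ.- a)          ≡⟨ ℤ.+-comm a (b ℤ.- a) ⟩
      b ℤ.- a ℤ.+ a            ≡⟨ ℤ.+-assoc b (ℤ.- a) a ⟩
      b ℤ.+ (ℤ.- a ℤ.+ a)      ≡⟨ ≡.cong (λ t → b ℤ.+ t) (ℤ.+-inverseˡ a) ⟩
      b ℤ.+ 0ℤ                 ≡⟨ ℤ.+-identityʳ b ⟩
      b                        ∎
      where open ℤ.≤-Reasoning

  module _ (y z : Carrier) where

    recurrence : Carrier → Carrier → ℕ → Carrier
    recurrence w₀ w₁ 0             = w₀
    recurrence w₀ w₁ 1             = w₁
    recurrence w₀ w₁ (suc (suc n)) = y * recurrence w₀ w₁ (suc n) - z * recurrence w₀ w₁ n

    uℕ vℕ : ℕ → Carrier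
    uℕ = recurrence 0# 1#
    vℕ = recurrence 2# y

    module _ (z#0 : z # 0#) where

      u v : ℤ → Carrier
      u (+ n)    = uℕ n
      u -[1+ n ] = (- uℕ (suc n)) / z ^ suc n ⟨ ^-#0 z#0 (suc n) ⟩
      v (+ n)    = vℕ n
      v -[1+ n ] = vℕ (suc n) / z ^ suc n ⟨ ^-#0 z#0 (suc n) ⟩

nonneg : ∀ {a} {A : Set a} {k} → 0ℤ ℤ.≤ k → k ℤ.< 0ℤ → A
nonneg 0≤k k<0 = ⊥-elim (ℤ.≤⇒≯ 0≤k k<0)

0≤n-k : ∀ {k n} → k ℤ.≤ n → 0ℤ ℤ.≤ n ℤ.- k
0≤n-k = ℤ.i≤j⇒0≤j-i

0≤n-k+1 : ∀ {k n} → k ℤ.≤ n → 0ℤ ℤ.≤ n ℤ.- k ℤ.+ 1ℤ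
0≤n-k+1 k≤n = ℤ.≤-trans (0≤n-k k≤n) (ℤ.i≤i+j _ 1ℤ)

k≤n+1 : ∀ {k n} → k ℤ.≤ n → k ℤ.≤ n ℤ.+ 1ℤ
k≤n+1 k≤n = ℤ.≤-trans k≤n (ℤ.i≤i+j _ 1ℤ)

open Complex public using (ℂ)
open LucasSequences Complex.heytingField public

-- With s k = (-1)ᵏ rᵏ y wₖ, each summand equals xⁿ⁻ᵏ (x s k - s (k + 1)), so that
-- both sums telescope.  For w = u this amounts to y uₖ₊₁ = vₖ₊₁ + 2z uₖ, and for
-- w = v to y vₖ₊₁ = (y² - 4z) uₖ₊₁ + 2z vₖ.  Both identities follow, for either
-- sign of k, from 2uₙ₊₁ = vₙ + y uₙ and 2vₙ₊₁ = y vₙ + (y² - 4z) uₙ for n ≥ 0,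
-- which hold because the two sides satisfy the same recurrence.
module Submission where

open import Algebra.Apartness.Bundles using (HeytingField; HeytingCommutativeRing)
open import Algebra.Bundles using (CommutativeRing)
open import Data.Fin.Base using (toℕ)
open import Data.Fin.Properties using (toℕ<n)
open import Data.Integer.Base as ℤ using (ℤ; +_; -[1+_]; 0ℤ; 1ℤ)
open import Data.Integer.Properties as ℤ using (≤-<-trans)
import Data.Integer.Solver
open import Data.Nat.Base as ℕ using (ℕ; zero; suc; _∸_)
import Data.Nat.Properties as ℕ
open import Data.Product.Base using (_×_; _,_; proj₂)
open import Defs using (module LucasSequences; nonneg; 0≤n-k; 0≤n-k+1; k≤n+1)
open import Relation.Binary.PropositionalEquality as ≡ using (_≡_)

-- Integer index arithmetic for sums over `c ≤ k ≤ n`.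

n-[c+i]≡∣n-c∣∸i : ∀ {c n i} → c ℤ.≤ n → i ℕ.≤ ℤ.∣ n ℤ.- c ∣ →
                  n ℤ.- (c ℤ.+ + i) ≡ + (ℤ.∣ n ℤ.- c ∣ ∸ i)
n-[c+i]≡∣n-c∣∸i {c} {n} {i} c≤n i≤m = begin
  n ℤ.- (c ℤ.+ + i)            ≡⟨ solve 3 (λ n c i → n :- (c :+ i) := n :- c :- i) ≡.refl n c (+ i) ⟩
  n ℤ.- c ℤ.- + i              ≡⟨ ≡.cong (ℤ._- + i) (ℤ.0≤i⇒+∣i∣≡i (0≤n-k c≤n)) ⟨
  + ℤ.∣ n ℤ.- c ∣ ℤ.- + i      ≡⟨ ℤ.m-n≡m⊖n ℤ.∣ n ℤ.- c ∣ i ⟩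
  -- The bound `i≤m` makes the truncated subtraction exact.
  ℤ.∣ n ℤ.- c ∣ ℤ.⊖ i          ≡⟨ ℤ.⊖-≥ i≤m ⟩
  + (ℤ.∣ n ℤ.- c ∣ ∸ i)        ∎
  where
  open ≡.≡-Reasoning
  open Data.Integer.Solver.+-*-Solver

n-c+1≡1+∣n-c∣ : ∀ {c n} → c ℤ.≤ n → n ℤ.- c ℤ.+ 1ℤ ≡ + suc ℤ.∣ n ℤ.- c ∣
n-c+1≡1+∣n-c∣ {c} {n} c≤n =
  ≡.trans (ℤ.+-comm (n ℤ.- c) 1ℤ) (≡.cong ℤ.suc (≡.sym (ℤ.0≤i⇒+∣i∣≡i (0≤n-k c≤n))))

c+∣n-c∣≡n : ∀ {c n} → c ℤ.≤ n → c ℤ.+ + ℤ.∣ n ℤ.- c ∣ ≡ n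
c+∣n-c∣≡n {c} {n} c≤n = ≡.trans (≡.cong (λ t → c ℤ.+ t) (ℤ.0≤i⇒+∣i∣≡i (0≤n-k c≤n)))
  (solve 2 (λ c n → c :+ (n :- c) := n) ≡.refl c n)
  where open Data.Integer.Solver.+-*-Solver

c+[1+i]≡[c+i]+1 : ∀ c i → c ℤ.+ + suc i ≡ c ℤ.+ + i ℤ.+ 1ℤ
c+[1+i]≡[c+i]+1 c i = solve 2 (λ c i → c :+ (con 1ℤ :+ i) := c :+ i :+ con 1ℤ) ≡.refl c (+ i)
  where open Data.Integer.Solver.+-*-Solver

module LucasIdentities {c ℓ₁ ℓ₂} (F : HeytingField c ℓ₁ ℓ₂) where

  open LucasSequences F
  open HeytingField F using (Carrier; heytingCommutativeRing; #⇒invertible)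
  open HeytingCommutativeRing heytingCommutativeRing using (commutativeRing)
  open CommutativeRing commutativeRing
    hiding (Carrier; _≈_; _+_; _*_; -_; _-_; 0#; 1#)
  open import Algebra.Apartness.Properties.HeytingCommutativeRing heytingCommutativeRing
    using (x-0≈x)
  open import Algebra.Properties.CommutativeMonoid.Sum +-commutativeMonoid using (sum; sum-cong-≋)
  open import Algebra.Properties.Ring ring
    using (-1*x≈-x; -‿involutive; -‿distribˡ-*; -‿distribʳ-*; +-cancelˡ; -‿+-comm)
  open import Algebra.Properties.Semiring.Exp semiring using (^-congˡ; ^-congʳ)
  open import Algebra.Solver.Ring.NaturalCoefficients.Default commutativeSemiring
  open import Relation.Binary.Reasoning.Setoid setoid

  -- Integer powers

  inverseʳ : ∀ {x} (x#0 : x # 0#) → x * inverse x x#0 ≈ 1#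
  inverseʳ {x} x#0 = trans (*-congʳ (sym (x-0≈x x))) (proj₂ (proj₂ (#⇒invertible x#0)))

  inverse-unique : ∀ {x a} (x#0 : x # 0#) → x * a ≈ 1# → inverse x x#0 ≈ a
  inverse-unique {x} {a} x#0 xa≈1 = begin
    i              ≈⟨ *-identityʳ i ⟨
    i * 1#         ≈⟨ *-congˡ xa≈1 ⟨
    i * (x * a)    ≈⟨ solve 3 (λ i x a → i :* (x :* a) := x :* i :* a) refl i x a ⟩
    x * i * a      ≈⟨ *-congʳ (inverseʳ x#0) ⟩
    1# * a         ≈⟨ *-identityˡ a ⟩
    a              ∎
    where
    i : Carrier
    i = inverse x x#0

  -- `inverse` is extracted from the apartness proof, so different proofs could a priori give
  -- different elements; uniqueness of inverses makes them agree.
  inverse-irrelevant : ∀ {x} (p q : x # 0#) → inverse x p ≈ inverse x q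
  inverse-irrelevant p q = inverse-unique p (inverseʳ q)

  inverse-^-suc : ∀ {x} (x#0 : x # 0#) n →
                  x * inverse (x ^ suc n) (^-#0 x#0 (suc n)) ≈ inverse (x ^ n) (^-#0 x#0 n)
  inverse-^-suc {x} x#0 n = sym (inverse-unique (^-#0 x#0 n) (begin
    x ^ n * (x * i)    ≈⟨ solve 3 (λ p x i → p :* (x :* i) := x :* p :* i) refl (x ^ n) x i ⟩
    x ^ suc n * i      ≈⟨ inverseʳ (^-#0 x#0 (suc n)) ⟩
    1#                 ∎))
    where
    i : Carrier
    i = inverse (x ^ suc n) (^-#0 x#0 (suc n))

  -- Equal exponents may still carry different side conditions. Only the negative branch evaluates
  -- them, and there `inverse-irrelevant` applies.
  ^ℤ-cong : ∀ x {j k} → j ≡ k → (p : j ℤ.< 0ℤ → x # 0#) (q : k ℤ.< 0ℤ → x # 0#) →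
            x ^ℤ j ⟨ p ⟩ ≈ x ^ℤ k ⟨ q ⟩
  ^ℤ-cong x {+ n}       ≡.refl p q = refl
  ^ℤ-cong x { -[1+ n ]} ≡.refl p q = ^-congˡ (suc n) (inverse-irrelevant (p ℤ.-<+) (q ℤ.-<+))

  ^ℤ-+1 : ∀ x k (p : k ℤ.+ 1ℤ ℤ.< 0ℤ → x # 0#) (q : k ℤ.< 0ℤ → x # 0#) →
          x ^ℤ k ℤ.+ 1ℤ ⟨ p ⟩ ≈ x * x ^ℤ k ⟨ q ⟩
  ^ℤ-+1 x (+ n) p q = ^-congʳ x (ℕ.+-comm n 1)
  -- The exponent passes from -1 to 0, so the left side is already `1#`.
  ^ℤ-+1 x -[1+ zero ] p q =
    sym (trans (*-congˡ (*-identityʳ _)) (inverseʳ (q ℤ.-<+)))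
  ^ℤ-+1 x -[1+ suc n ] p q = begin
    a ^ suc n              ≈⟨ ^-congˡ (suc n) (inverse-irrelevant (p ℤ.-<+) (q ℤ.-<+)) ⟩
    b ^ suc n              ≈⟨ *-identityˡ (b ^ suc n) ⟨
    1# * b ^ suc n         ≈⟨ *-congʳ (inverseʳ (q ℤ.-<+)) ⟨
    x * b * b ^ suc n      ≈⟨ *-assoc x b (b ^ suc n) ⟩
    x * b ^ suc (suc n)    ∎
    where
    a b : Carrier
    a = inverse x (p ℤ.-<+)
    b = inverse x (q ℤ.-<+)

  -[-1^[k+1]]≈-1^k : ∀ k → - (-1^ (k ℤ.+ 1ℤ)) ≈ -1^ k
  -[-1^[k+1]]≈-1^k k = begin
    - (-1^ (k ℤ.+ 1ℤ))     ≈⟨ -‿cong (^ℤ-+1 (- 1#) k (λ _ → -1#0) (λ _ → -1#0)) ⟩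
    - (- 1# * -1^ k)       ≈⟨ -‿cong (-1*x≈-x (-1^ k)) ⟩
    - - (-1^ k)            ≈⟨ -‿involutive (-1^ k) ⟩
    -1^ k                  ∎

  -- Lucas sequences

  module _ (y z : Carrier) where

    -- The discriminant of the characteristic polynomial t² - y t + z.
    D : Carrier
    D = y ^ 2 - 4# * z

    -- Written with `- z * f n` instead of a subtraction: the semiring solver has no negation and
    -- takes `- z` as a variable.
    Solution : (ℕ → Carrier) → Set ℓ₁
    Solution f = ∀ n → f (suc (suc n)) ≈ y * f (suc n) + - z * f n

    -- Two consecutive values determine a solution, so an identity between solutions only needs
    -- checking at 0 and 1.
    solution-unique : ∀ {f g} → Solution f → Solution g → f 0 ≈ g 0 → f 1 ≈ g 1 → ∀ n → f n ≈ g n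
    solution-unique F G p q zero          = p
    solution-unique F G p q (suc zero)    = q
    solution-unique F G p q (suc (suc n)) = trans (F n) (trans
      (+-cong (*-congˡ (solution-unique F G p q (suc n))) (*-congˡ (solution-unique F G p q n)))
      (sym (G n)))

    recurrence-solution : ∀ a b → Solution (recurrence y z a b)
    recurrence-solution a b n = +-congˡ (-‿distribˡ-* z (recurrence y z a b n))

    shift-solution : ∀ {f} → Solution f → Solution (λ n → f (suc n))
    shift-solution F n = F (suc n)

    *-solution : ∀ a {f} → Solution f → Solution (λ n → a * f n)
    *-solution a {f} F n = trans (*-congˡ (F n))
      (solve 5 (λ a y z f g → a :* (y :* f :+ z :* g) := y :* (a :* f) :+ z :* (a :* g))
        refl a y (- z) (f (suc n)) (f n))

    +-solution : ∀ {f g} → Solution f → Solution g → Solution (λ n → f n + g n)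
    +-solution {f} {g} F G n = trans (+-cong (F n) (G n))
      (solve 6 (λ y z a b c d → (y :* a :+ z :* b) :+ (y :* c :+ z :* d) :=
                                y :* (a :+ c) :+ z :* (b :+ d))
        refl y (- z) (f (suc n)) (f n) (g (suc n)) (g n))

    U V : ℕ → Carrier
    U = uℕ y z
    V = vℕ y z

    U-solution : Solution U
    U-solution = recurrence-solution 0# 1#

    V-solution : Solution V
    V-solution = recurrence-solution 2# y

    D≈y*y+4*-z : D ≈ y * y + 4# * - z
    D≈y*y+4*-z = +-cong (*-congˡ (*-identityʳ y)) (-‿distribʳ-* 4# z)

    -- The common initial values are 2 at n = 0 and 2y at n = 1.
    2*U[1+n] : ∀ n → 2# * U (suc n) ≈ V n + y * U n
    2*U[1+n] = solution-unique
      (*-solution 2# (shift-solution U-solution))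
      (+-solution V-solution (*-solution y U-solution))
      (solve 1 (λ y → :2 :* con 1 := :2 :+ y :* con 0) refl y)
      (trans (*-congˡ (U-solution 0))
        (solve 2 (λ y z → :2 :* (y :* con 1 :+ z :* con 0) := y :+ y :* con 1) refl y (- z)))
      where
      :2 : ∀ {n} → Polynomial n
      :2 = con 1 :+ con 1

    -- The common initial values are 2y at n = 0 and 2y² - 4z at n = 1.
    2*V[1+n] : ∀ n → 2# * V (suc n) ≈ y * V n + D * U n
    2*V[1+n] = solution-unique
      (*-solution 2# (shift-solution V-solution))
      (+-solution (*-solution y V-solution) (*-solution D U-solution))
      (solve 2 (λ y d → :2 :* y := y :* :2 :+ d :* con 0) refl y D)
      (begin
        2# * V 2                             ≈⟨ *-congˡ (V-solution 0) ⟩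
        2# * (y * y + - z * 2#)              ≈⟨ solve 2 (λ y z →
          :2 :* (y :* y :+ z :* :2) := y :* y :+ (y :* y :+ (:2 :+ :2) :* z) :* con 1) refl y (- z) ⟩
        y * y + (y * y + 4# * - z) * 1#      ≈⟨ +-congˡ (*-congʳ D≈y*y+4*-z) ⟨
        y * y + D * 1#                       ∎)
      where
      :2 : ∀ {n} → Polynomial n
      :2 = con 1 :+ con 1

    -- Doubling the recurrence gives 2y w(n+1) = 2w(n+2) + 2z w(n); inserting the hypothesis and
    -- cancelling one y w(n+1) avoids dividing by 2. It is used with `t` equal to `V (suc n)` for
    -- `U` and to `D * U (suc n)` for `V`.
    double-step : ∀ {w} → Solution w → ∀ n t → 2# * w (suc (suc n)) ≈ t + y * w (suc n) →
                  y * w (suc n) ≈ t + 2# * z * w n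
    double-step {w} W n t eq = +-cancelˡ (y * w₁) _ _ (begin
      y * w₁ + y * w₁
        ≈⟨ +-identityʳ _ ⟨
      y * w₁ + y * w₁ + 0#
        ≈⟨ +-congˡ (zeroʳ (2# * w₀)) ⟨
      y * w₁ + y * w₁ + 2# * w₀ * 0#
        ≈⟨ +-congˡ (*-congˡ (-‿inverseˡ z)) ⟨
      -- A zero in this form supplies both the `- z` of the recurrence and the `z` of the result.
      y * w₁ + y * w₁ + 2# * w₀ * (- z + z)
        ≈⟨ solve 5 (λ y z z′ a b →
             y :* a :+ y :* a :+ (con 1 :+ con 1) :* b :* (z′ :+ z) :=
             (con 1 :+ con 1) :* (y :* a :+ z′ :* b) :+ (con 1 :+ con 1) :* z :* b) refl y z (- z) w₁ w₀ ⟩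
      2# * (y * w₁ + - z * w₀) + 2# * z * w₀
        ≈⟨ +-congʳ (*-congˡ (W n)) ⟨
      2# * w (suc (suc n)) + 2# * z * w₀
        ≈⟨ +-congʳ (trans eq (+-comm t (y * w₁))) ⟩
      y * w₁ + t + 2# * z * w₀
        ≈⟨ +-assoc (y * w₁) t _ ⟩
      y * w₁ + (t + 2# * z * w₀) ∎)
      where
      w₀ w₁ : Carrier
      w₀ = w n
      w₁ = w (suc n)

    -- Extension to negative indices.

    module _ (z#0 : z # 0#) where

      -- The inverse of a power, as in the quotients defining `u` and `v`, not the power of an
      -- inverse used for integer exponents.
      z⁻ : ℕ → Carrier
      z⁻ n = inverse (z ^ n) (^-#0 z#0 n)

      z⁻0≈1 : z⁻ 0 ≈ 1#
      z⁻0≈1 = inverse-unique (^-#0 z#0 0) (*-identityˡ 1#)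

      -- The index is -n. At n = 0 it leaves the negative branch, so the quotient formula is checked
      -- there separately; for n > 0 it is the definition.
      u[-n] : ∀ n → u y z z#0 (-[1+ n ] ℤ.+ 1ℤ) ≈ - U n * z⁻ n
      u[-n] zero    = sym (trans (sym (-‿distribˡ-* 0# (z⁻ 0)))
        (trans (-‿cong (zeroˡ (z⁻ 0))) (trans (sym (+-identityˡ (- 0#))) (-‿inverseʳ 0#))))
      u[-n] (suc n) = refl

      v[-n] : ∀ n → v y z z#0 (-[1+ n ] ℤ.+ 1ℤ) ≈ V n * z⁻ n
      v[-n] zero    = sym (trans (*-congˡ z⁻0≈1) (*-identityʳ 2#))
      v[-n] (suc n) = refl

      y*u[k+1] : ∀ k → y * u y z z#0 (k ℤ.+ 1ℤ) ≈ v y z z#0 (k ℤ.+ 1ℤ) + 2# * z * u y z z#0 k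
      y*u[k+1] (+ n) rewrite ℕ.+-comm n 1 = double-step U-solution n (V (suc n)) (2*U[1+n] (suc n))
      -- Here k = -(n+1). Every term is brought to the factor `z⁻ n`, and what remains is `2*U[1+n]`
      -- rearranged.
      y*u[k+1] -[1+ n ] = begin
        y * u y z z#0 (-[1+ n ] ℤ.+ 1ℤ)
          ≈⟨ *-congˡ (u[-n] n) ⟩
        y * (- U n * z⁻ n)
          ≈⟨ solve 3 (λ y a i → y :* (a :* i) := (y :* a) :* i) refl y (- U n) (z⁻ n) ⟩
        y * - U n * z⁻ n
          ≈⟨ *-congʳ negated ⟩
        (V n + 2# * - U (suc n)) * z⁻ n
          ≈⟨ distribʳ (z⁻ n) (V n) _ ⟩
        V n * z⁻ n + 2# * - U (suc n) * z⁻ n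
          -- Lowering the denominator's index produces the factor `z` that stands before `u` at k.
          ≈⟨ +-congˡ (*-congˡ (inverse-^-suc z#0 n)) ⟨
        V n * z⁻ n + 2# * - U (suc n) * (z * z⁻ (suc n))
          ≈⟨ +-cong (v[-n] n)
               (solve 4 (λ t z b j → t :* z :* (b :* j) := t :* b :* (z :* j)) refl 2# z (- U (suc n)) (z⁻ (suc n))) ⟨
        v y z z#0 (-[1+ n ] ℤ.+ 1ℤ) + 2# * z * (- U (suc n) * z⁻ (suc n)) ∎
        where
        negated : y * - U n ≈ V n + 2# * - U (suc n)
        negated = begin
          y * - U n                                ≈⟨ -‿distribʳ-* y (U n) ⟨
          - (y * U n)                              ≈⟨ +-identityˡ _ ⟨
          0# - y * U n                             ≈⟨ +-congʳ (-‿inverseʳ (V n)) ⟨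
          V n - V n - y * U n                      ≈⟨ +-assoc (V n) _ _ ⟩
          V n + (- V n - y * U n)                  ≈⟨ +-congˡ (-‿+-comm (V n) (y * U n)) ⟩
          V n - (V n + y * U n)                    ≈⟨ +-congˡ (-‿cong (2*U[1+n] n)) ⟨
          V n - 2# * U (suc n)                     ≈⟨ +-congˡ (-‿distribʳ-* 2# (U (suc n))) ⟩
          V n + 2# * - U (suc n)                   ∎

      y*v[k+1] : ∀ k → y * v y z z#0 (k ℤ.+ 1ℤ) ≈ D * u y z z#0 (k ℤ.+ 1ℤ) + 2# * z * v y z z#0 k
      y*v[k+1] (+ n) rewrite ℕ.+-comm n 1 = double-step V-solution n (D * U (suc n))
        (trans (2*V[1+n] (suc n)) (+-comm _ _))
      -- The same reduction, now to `2*V[1+n]`; only `u` changes sign at negative indices, so the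
      -- sign falls on the `D` term.
      y*v[k+1] -[1+ n ] = begin
        y * v y z z#0 (-[1+ n ] ℤ.+ 1ℤ)
          ≈⟨ *-congˡ (v[-n] n) ⟩
        y * (V n * z⁻ n)
          ≈⟨ *-assoc y (V n) (z⁻ n) ⟨
        y * V n * z⁻ n
          ≈⟨ *-congʳ negated ⟩
        (D * - U n + 2# * V (suc n)) * z⁻ n
          ≈⟨ distribʳ (z⁻ n) _ _ ⟩
        D * - U n * z⁻ n + 2# * V (suc n) * z⁻ n
          ≈⟨ +-cong (*-assoc D (- U n) (z⁻ n)) (*-congˡ (sym (inverse-^-suc z#0 n))) ⟩
        D * (- U n * z⁻ n) + 2# * V (suc n) * (z * z⁻ (suc n))
          ≈⟨ +-cong (*-congˡ (u[-n] n))
               (solve 4 (λ t z b j → t :* z :* (b :* j) := t :* b :* (z :* j)) refl 2# z (V (suc n)) (z⁻ (suc n))) ⟨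
        D * u y z z#0 (-[1+ n ] ℤ.+ 1ℤ) + 2# * z * (V (suc n) * z⁻ (suc n)) ∎
        where
        negated : y * V n ≈ D * - U n + 2# * V (suc n)
        negated = begin
          y * V n                                  ≈⟨ +-identityʳ _ ⟨
          y * V n + 0#                             ≈⟨ +-congˡ (-‿inverseʳ (D * U n)) ⟨
          y * V n + (D * U n - D * U n)            ≈⟨ +-assoc _ _ _ ⟨
          y * V n + D * U n - D * U n              ≈⟨ +-cong (sym (2*V[1+n] n)) (-‿distribʳ-* D (U n)) ⟩
          2# * V (suc n) + D * - U n               ≈⟨ +-comm _ _ ⟩
          D * - U n + 2# * V (suc n)               ∎

  -- Telescoping

  -- Since the hypothesis holds for all bound proofs `p` and `q`, the ones built inside `∑ℤ` never
  -- have to be named.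
  ∑ℤ-cong-sum : ∀ a b (a≤b : a ℤ.≤ b) (f : ∀ k → a ℤ.≤ k → k ℤ.≤ b → Carrier) (h : ℕ → Carrier) →
    (∀ i → i ℕ.≤ ℤ.∣ b ℤ.- a ∣ → ∀ p q → f (a ℤ.+ + i) p q ≈ h i) →
    ∑ℤ a b a≤b f ≈ sum {suc ℤ.∣ b ℤ.- a ∣} (λ i → h (toℕ i))
  ∑ℤ-cong-sum a b a≤b f h f≈h =
    -- With the head split off, `toℕ<n i` is exactly the bound for the shifted index `suc (toℕ i)`.
    +-cong (f≈h 0 ℕ.z≤n _ _) (sum-cong-≋ {ℤ.∣ b ℤ.- a ∣} (λ i → f≈h (suc (toℕ i)) (toℕ<n i) _ _))

  -- The i-th summand is x^(m+1-i) g(i) - x^(m-i) g(i+1), so neighbours cancel. The induction splits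
  -- off the first summand and shifts `g`.
  sum-telescope : ∀ x m (g : ℕ → Carrier) →
    sum {suc m} (λ i → x ^ (m ∸ toℕ i) * (x * g (toℕ i) - g (suc (toℕ i))))
      ≈ x ^ suc m * g 0 - g (suc m)
  sum-telescope x zero g =
    solve 3 (λ x a b → con 1 :* (x :* a :+ b) :+ con 0 := x :* con 1 :* a :+ b) refl x (g 0) (- g 1)
  sum-telescope x (suc m) g = begin
    p * (x * g 0 - g 1) + sum {suc m} (λ i → x ^ (m ∸ toℕ i) * (x * g (suc (toℕ i)) - g (suc (suc (toℕ i)))))
      ≈⟨ +-congˡ (sum-telescope x m (λ i → g (suc i))) ⟩
    p * (x * g 0 - g 1) + (p * g 1 - g (suc (suc m)))
      ≈⟨ solve 6 (λ p x a b b′ d → p :* (x :* a :+ b′) :+ (p :* b :+ d) :=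
           x :* p :* a :+ d :+ p :* (b :+ b′)) refl p x (g 0) (g 1) (- g 1) (- g (suc (suc m))) ⟩
    x * p * g 0 - g (suc (suc m)) + p * (g 1 - g 1)
      ≈⟨ +-congˡ (trans (*-congˡ (-‿inverseʳ (g 1))) (zeroʳ p)) ⟩
    x * p * g 0 - g (suc (suc m)) + 0#
      ≈⟨ +-identityʳ _ ⟩
    x * p * g 0 - g (suc (suc m)) ∎
    where
    p : Carrier
    p = x ^ suc m

  -- Telescoping depends only on the shape of the bracket `e`, so `w` is left arbitrary and one
  -- argument covers both Lucas sequences.
  ∑ℤ-telescope : ∀ x r y (w e : ℤ → Carrier) →
    (∀ k → e k ≈ r * (y * w (k ℤ.+ 1ℤ)) + x * (y * w k)) →
    ∀ c n (c≤n : c ℤ.≤ n) (r#0 : c ℤ.< 0ℤ → r # 0#) →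
    ∑ℤ c n c≤n (λ k c≤k k≤n →
        -1^ k * x ^ℤ (n ℤ.- k) ⟨ nonneg (0≤n-k k≤n) ⟩
              * r ^ℤ k ⟨ (λ k<0 → r#0 (≤-<-trans c≤k k<0)) ⟩
              * e k)
      ≈ -1^ n * y * r ^ℤ (n ℤ.+ 1ℤ) ⟨ (λ n+1<0 → r#0 (≤-<-trans (k≤n+1 c≤n) n+1<0)) ⟩
              * w (n ℤ.+ 1ℤ)
        + -1^ c * r ^ℤ c ⟨ r#0 ⟩ * y * x ^ℤ (n ℤ.- c ℤ.+ 1ℤ) ⟨ nonneg (0≤n-k+1 c≤n) ⟩
                * w c
  ∑ℤ-telescope x r y w e step c n c≤n r#0 = begin
    ∑ℤ c n c≤n term
      ≈⟨ ∑ℤ-cong-sum c n c≤n term (λ i → x ^ (m ∸ i) * (x * g i - g (suc i)))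
           summand ⟩
    sum {suc m} (λ i → x ^ (m ∸ toℕ i) * (x * g (toℕ i) - g (suc (toℕ i))))
      ≈⟨ sum-telescope x m g ⟩
    x ^ suc m * g 0 - g (suc m)
      ≈⟨ +-cong first last ⟩
    -1^ c * r ^ℤ c ⟨ r#0 ⟩ * y * x ^ℤ (n ℤ.- c ℤ.+ 1ℤ) ⟨ nonneg (0≤n-k+1 c≤n) ⟩ * w c
      + -1^ n * y * r ^ℤ (n ℤ.+ 1ℤ) ⟨ _ ⟩ * w (n ℤ.+ 1ℤ)
      ≈⟨ +-comm _ _ ⟩
    _ ∎
    where
    m : ℕ
    m = ℤ.∣ n ℤ.- c ∣

    r#0′ : ∀ {k} → c ℤ.≤ k → k ℤ.< 0ℤ → r # 0#
    r#0′ c≤k k<0 = r#0 (≤-<-trans c≤k k<0)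

    term : ∀ k → c ℤ.≤ k → k ℤ.≤ n → Carrier
    term k c≤k k≤n = -1^ k * x ^ℤ (n ℤ.- k) ⟨ nonneg (0≤n-k k≤n) ⟩ * r ^ℤ k ⟨ r#0′ c≤k ⟩ * e k

    -- The telescoping term. The side condition is an argument because the same term arises with
    -- different proofs.
    G : ∀ k → (k ℤ.< 0ℤ → r # 0#) → Carrier
    G k p = -1^ k * r ^ℤ k ⟨ p ⟩ * (y * w k)

    G-cong : ∀ {j k} → j ≡ k → ∀ p q → G j p ≈ G k q
    G-cong {j} ≡.refl p q = *-congʳ (*-congˡ (^ℤ-cong r {j} ≡.refl p q))

    g : ℕ → Carrier
    g i = G (c ℤ.+ + i) (r#0′ (ℤ.i≤i+j c (+ i)))

    -- The minus sign absorbs one factor -1. This serves both the summands and the upper boundary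
    -- term.
    -G[k+1] : ∀ k p → - G (k ℤ.+ 1ℤ) p ≈ -1^ k * r ^ℤ k ℤ.+ 1ℤ ⟨ p ⟩ * (y * w (k ℤ.+ 1ℤ))
    -G[k+1] k p = begin
      - (s * ρ * ω)      ≈⟨ -‿distribˡ-* (s * ρ) ω ⟩
      - (s * ρ) * ω      ≈⟨ *-congʳ (-‿distribˡ-* s ρ) ⟩
      - s * ρ * ω        ≈⟨ *-congʳ (*-congʳ (-[-1^[k+1]]≈-1^k k)) ⟩
      -1^ k * ρ * ω      ∎
      where
      s ρ ω : Carrier
      s = -1^ (k ℤ.+ 1ℤ)
      ρ = r ^ℤ k ℤ.+ 1ℤ ⟨ p ⟩
      ω = y * w (k ℤ.+ 1ℤ)

    summand : ∀ i → i ℕ.≤ m → ∀ p q →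
              term (c ℤ.+ + i) p q ≈ x ^ (m ∸ i) * (x * g i - g (suc i))
    summand i i≤m p q = begin
      term k p q
        ≈⟨ *-cong (*-cong (*-congˡ (^ℤ-cong x (n-[c+i]≡∣n-c∣∸i c≤n i≤m) _ (nonneg (ℤ.+≤+ ℕ.z≤n))))
             (^ℤ-cong r {k} ≡.refl _ q′)) (step k) ⟩
      s * ξ * ρ * (r * ω₁ + x * ω₀)
        ≈⟨ solve 7 (λ s ξ ρ r x a b → s :* ξ :* ρ :* (r :* b :+ x :* a) :=
             ξ :* (x :* (s :* ρ :* a) :+ s :* (r :* ρ) :* b)) refl s ξ ρ r x ω₀ ω₁ ⟩
      ξ * (x * g i + s * (r * ρ) * ω₁)
        -- The factor `r` from the bracket raises the power to the one in the next telescoping term.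
        ≈⟨ *-congˡ (+-congˡ (*-congʳ (*-congˡ (^ℤ-+1 r k q″ q′)))) ⟨
      ξ * (x * g i + s * r ^ℤ k ℤ.+ 1ℤ ⟨ q″ ⟩ * ω₁)
        ≈⟨ *-congˡ (+-congˡ (-G[k+1] k q″)) ⟨
      ξ * (x * g i - G (k ℤ.+ 1ℤ) q″)
        ≈⟨ *-congˡ (+-congˡ (-‿cong (G-cong (c+[1+i]≡[c+i]+1 c i) _ q″))) ⟨
      ξ * (x * g i - g (suc i)) ∎
      where
      k : ℤ
      k = c ℤ.+ + i
      q′ : k ℤ.< 0ℤ → r # 0#
      q′ = r#0′ (ℤ.i≤i+j c (+ i))
      q″ : k ℤ.+ 1ℤ ℤ.< 0ℤ → r # 0#
      -- `k≤n+1` is applied to c ≤ k and yields c ≤ k + 1.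
      q″ = r#0′ (k≤n+1 (ℤ.i≤i+j c (+ i)))
      s ξ ρ ω₀ ω₁ : Carrier
      s  = -1^ k
      ξ  = x ^ (m ∸ i)
      ρ  = r ^ℤ k ⟨ q′ ⟩
      ω₀ = y * w k
      ω₁ = y * w (k ℤ.+ 1ℤ)

    first : x ^ suc m * g 0
      ≈ -1^ c * r ^ℤ c ⟨ r#0 ⟩ * y * x ^ℤ (n ℤ.- c ℤ.+ 1ℤ) ⟨ nonneg (0≤n-k+1 c≤n) ⟩ * w c
    first = begin
      x ^ suc m * g 0
        ≈⟨ *-cong (^ℤ-cong x (≡.sym (n-c+1≡1+∣n-c∣ c≤n)) (nonneg (ℤ.+≤+ ℕ.z≤n)) _)
             (G-cong (ℤ.+-identityʳ c) _ r#0) ⟩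
      x ^ℤ (n ℤ.- c ℤ.+ 1ℤ) ⟨ _ ⟩ * (-1^ c * r ^ℤ c ⟨ r#0 ⟩ * (y * w c))
        ≈⟨ solve 5 (λ ξ s ρ y w → ξ :* (s :* ρ :* (y :* w)) := s :* ρ :* y :* ξ :* w) refl _ _ _ _ _ ⟩
      _ ∎

    last : - g (suc m) ≈ -1^ n * y * r ^ℤ (n ℤ.+ 1ℤ) ⟨ r#0′ (k≤n+1 c≤n) ⟩ * w (n ℤ.+ 1ℤ)
    last = begin
      - g (suc m)
        -- The final index c + (m + 1) equals n + 1 because m = |n - c| and c ≤ n.
        ≈⟨ -‿cong (G-cong (≡.trans (c+[1+i]≡[c+i]+1 c m) (≡.cong (ℤ._+ 1ℤ) (c+∣n-c∣≡n c≤n))) _ _) ⟩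
      - G (n ℤ.+ 1ℤ) (r#0′ (k≤n+1 c≤n))
        ≈⟨ -G[k+1] n _ ⟩
      -1^ n * r ^ℤ n ℤ.+ 1ℤ ⟨ _ ⟩ * (y * w (n ℤ.+ 1ℤ))
        ≈⟨ solve 4 (λ s ρ y w → s :* ρ :* (y :* w) := s :* y :* ρ :* w) refl _ _ _ _ ⟩
      _ ∎

  -- The brackets of the two sums in telescoping form.

  module _ (y z x r : Carrier) (z#0 : z # 0#) where

    -- Replacing y u(k+1) on the right by `y*u[k+1]` leaves a semiring identity.
    u-summand : ∀ k →
      r * v y z z#0 (k ℤ.+ 1ℤ) + (x * y + 2# * r * z) * u y z z#0 k
        ≈ r * (y * u y z z#0 (k ℤ.+ 1ℤ)) + x * (y * u y z z#0 k)
    u-summand k = sym (trans (+-congʳ (*-congˡ (y*u[k+1] y z z#0 k)))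
      (solve 7 (λ x y z r t a b → r :* (b :+ t :* z :* a) :+ x :* (y :* a) :=
                                  r :* b :+ (x :* y :+ t :* r :* z) :* a) refl
        x y z r 2# (u y z z#0 k) (v y z z#0 (k ℤ.+ 1ℤ))))

    v-summand : ∀ k →
      (y ^ 2 - 4# * z) * r * u y z z#0 (k ℤ.+ 1ℤ) + (x * y + 2# * r * z) * v y z z#0 k
        ≈ r * (y * v y z z#0 (k ℤ.+ 1ℤ)) + x * (y * v y z z#0 k)
    v-summand k = sym (trans (+-congʳ (*-congˡ (y*v[k+1] y z z#0 k)))
      -- The discriminant is the single variable `d`, which hides its subtraction from the solver.
      (solve 8 (λ x y z r t d a b → r :* (d :* b :+ t :* z :* a) :+ x :* (y :* a) :=
                                    d :* r :* b :+ (x :* y :+ t :* r :* z) :* a) refl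
        x y z r 2# (y ^ 2 - 4# * z) (v y z z#0 k) (u y z z#0 (k ℤ.+ 1ℤ))))

open import Defs

theorem2 : (y z x r : ℂ) (y#0 : y # 0#) (z#0 : z # 0#) (c n : ℤ) (c≤n : c ℤ.≤ n)
    (r#0 : c ℤ.< 0ℤ → r # 0#) →
    ( ∑ℤ c n c≤n (λ k c≤k k≤n →
          -1^ k * x ^ℤ (n ℤ.- k) ⟨ nonneg (0≤n-k k≤n) ⟩
                * r ^ℤ k ⟨ (λ k<0 → r#0 (≤-<-trans c≤k k<0)) ⟩
                * (r * v y z z#0 (k ℤ.+ 1ℤ) + (x * y + 2# * r * z) * u y z z#0 k))
      ≈ -1^ n * y * r ^ℤ (n ℤ.+ 1ℤ) ⟨ (λ n+1<0 → r#0 (≤-<-trans (k≤n+1 c≤n) n+1<0)) ⟩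
              * u y z z#0 (n ℤ.+ 1ℤ)
        + -1^ c * r ^ℤ c ⟨ r#0 ⟩ * y * x ^ℤ (n ℤ.- c ℤ.+ 1ℤ) ⟨ nonneg (0≤n-k+1 c≤n) ⟩
                * u y z z#0 c )
    ×
    ( ∑ℤ c n c≤n (λ k c≤k k≤n →
          -1^ k * x ^ℤ (n ℤ.- k) ⟨ nonneg (0≤n-k k≤n) ⟩
                * r ^ℤ k ⟨ (λ k<0 → r#0 (≤-<-trans c≤k k<0)) ⟩
                * ((y ^ 2 - 4# * z) * r * u y z z#0 (k ℤ.+ 1ℤ) + (x * y + 2# * r * z) * v y z z#0 k))
      ≈ -1^ n * y * r ^ℤ (n ℤ.+ 1ℤ) ⟨ (λ n+1<0 → r#0 (≤-<-trans (k≤n+1 c≤n) n+1<0)) ⟩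
              * v y z z#0 (n ℤ.+ 1ℤ)
        + -1^ c * r ^ℤ c ⟨ r#0 ⟩ * y * x ^ℤ (n ℤ.- c ℤ.+ 1ℤ) ⟨ nonneg (0≤n-k+1 c≤n) ⟩
                * v y z z#0 c )
theorem2 y z x r y#0 z#0 c n c≤n r#0 =
  ∑ℤ-telescope x r y (u y z z#0) _ (u-summand y z x r z#0) c n c≤n r#0 ,
  ∑ℤ-telescope x r y (v y z z#0) _ (v-summand y z x r z#0) c n c≤n r#0
  where open LucasIdentities Complex.heytingField using (∑ℤ-telescope; u-summand; v-summand)
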